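{- Let $\Delta' \preceq \Delta$. If $\Delta' \rightsquigarrow_\pi \Theta'$ then $\Delta \rightsquigarrow_\pi \Theta$ for some $\Theta$ such that $\Theta' \preceq \Theta$.
   Context: lqCCS is a quantum process calculus with sum $P+Q$ and if-then-else $\mathrm{if}\ e\ \mathrm{then}\ P\ \mathrm{else}\ Q$. The refinement relation $P' \preceq P$ is the smallest reflexive relation that is preserved by all process constructors (parallel, sum, prefixes, restriction, if-then-else) and satisfies: $P' \preceq P + Q$ whenever $P' \preceq P$; $Q' \preceq P + Q$ whenever $Q' \preceq Q$; and $\mathrm{if}\ e\ \mathrm{then}\ P'\ \mathrm{else}\ Q' \preceq P + Q$ for any boolean expression $e$ whenever $P' \preceq P$ and $Q' \preceq Q$ (i.e. $P'$ is obtained from $P$ by replacing some sums $Q+Q'$ by $Q$, $Q'$ or a boolean conditional between them). Extended configurations $\langle\!\langle \rho, P, R \rangle\!\rangle$ (density operator, process, observer) are refined by refining the process and keeping $\rho$ and $R$; the deadlock configuration $\bot$ refines every configuration; refinement of distributions is defined by linearity. $\rightsquigarrow_\pi$ is the enhanced semantics: transitions indexed by $\pi = \diamond$ when only the process moves (standard probabilistic reduction) or $\pi \in \{\ell,r\}^*$ naming the parallel component of the observer that acts (observer applies a superoperator/measurement, receives a value output by the process, or sends a value to it), lifted to distributions so that all configurations in the support move with the same index, configurations with no $\pi$-move going to $\overline{\bot}$. -}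

module Defs where

open import Algebra.Structures using (IsCommutativeRing)
open import Axiom.ExcludedMiddle using (ExcludedMiddle)
open import Data.Bool using (Bool; true; false; if_then_else_; not; _∨_)
open import Data.Fin using (Fin; toℕ; finToFun; funToFin)
import Data.Fin.Properties as Fin
open import Data.List using (List; []; _∷_; _++_; map; foldr; filter; allFin)
open import Data.List.Membership.Propositional using (_∈_)
open import Data.List.Properties using (map-++; map-∘)
open import Data.List.Relation.Binary.Pointwise using (Pointwise)
open import Data.List.Relation.Unary.All using (All; []; _∷_)
import Data.List.Relation.Unary.All.Properties as All
open import Data.List.Relation.Unary.Any using (here; there)
open import Data.Nat using (ℕ; _^_; _≤ᵇ_)
open import Data.Product using (Σ; ∃; ∃₂; _×_; _,_; proj₁; proj₂; map₁; map₂)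
open import Data.Sum using (_⊎_)
open import Data.Vec as Vec using (Vec; lookup; tabulate)
import Data.Vec.Functional as Functional
import Data.Vec.Membership.DecPropositional as VecMembership
open import Data.Vec.Relation.Unary.Unique.Propositional using (Unique)
open import Function using (_∘_)
open import Level using (0ℓ)
open import Relation.Binary.PropositionalEquality
  using (_≡_; _≢_; refl; sym; trans; cong; cong₂; subst; module ≡-Reasoning)
open import Relation.Binary.Structures using (IsStrictTotalOrder)
open import Relation.Nullary using (¬_; Dec; does)
open import Relation.Nullary.Decidable using (¬?; _⊎-dec_)

-- A Dedekind-complete ordered field.  Classically there is exactly one such
-- structure up to isomorphism.
record Reals : Set₁ where
  infixl 6 _+_
  infixl 7 _*_
  infix  8 -_
  infix  4 _<_ _≤_
  field
    Carrier            : Set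
    _<_                : Carrier → Carrier → Set
    _+_ _*_            : Carrier → Carrier → Carrier
    -_                 : Carrier → Carrier
    0# 1#              : Carrier
    isCommutativeRing  : IsCommutativeRing _≡_ _+_ _*_ -_ 0# 1#
    inverse            : ∀ x → x ≢ 0# → ∃ λ y → x * y ≡ 1#
    isStrictTotalOrder : IsStrictTotalOrder _≡_ _<_
    0<1                : 0# < 1#
    +-monoʳ-<          : ∀ x {y z} → y < z → x + y < x + z
    *-pos              : ∀ {x y} → 0# < x → 0# < y → 0# < x * y

  _≤_ : Carrier → Carrier → Set
  x ≤ y = x < y ⊎ x ≡ y

  field
    supremum : (S : Carrier → Set) → ∃ S → (∃ λ b → ∀ x → S x → x ≤ b) →
               ∃ λ s → (∀ x → S x → x ≤ s) ×
                       (∀ b → (∀ x → S x → x ≤ b) → s ≤ b)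

  open IsCommutativeRing isCommutativeRing public
    using (+-identityˡ; +-identityʳ; +-assoc; distribˡ; zeroʳ; *-identityʳ)
  open IsStrictTotalOrder isStrictTotalOrder public using (_≟_)

-- Finitely supported probability distributions.
module Distributions (em : ExcludedMiddle 0ℓ) (ℝ : Reals) where

  open Reals ℝ

  sum : List Carrier → Carrier
  sum = foldr _+_ 0#

  -- The formal convex combination Σᵢ pᵢ • aᵢ.  An element of A may occur
  -- several times; distributions are compared by _≈_ below.
  record Dist (A : Set) : Set where
    constructor dist
    field
      entries  : List (Carrier × A)
      positive : All (0# <_) (map proj₁ entries)
      total    : sum (map proj₁ entries) ≡ 1#

  open Dist public

  private variable A B : Set

  mass : Dist A → A → Carrier
  mass Δ a = sum (map (λ (p , x) → if does (em {x ≡ a}) then p else 0#)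
                      (entries Δ))

  infix 4 _≈_
  _≈_ : Dist A → Dist A → Set
  Δ ≈ Δ′ = ∀ a → mass Δ a ≡ mass Δ′ a

  point : A → Dist A
  point a = dist ((1# , a) ∷ []) (0<1 ∷ []) (+-identityʳ 1#)

  mapD : (A → B) → Dist A → Dist B
  mapD f (dist es pos tot) =
    dist (map (map₂ f) es) (subst (All (0# <_)) same pos)
         (trans (cong sum (sym same)) tot)
    where
    same : map proj₁ es ≡ map proj₁ (map (map₂ f) es)
    same = map-∘ es

  private
    scale : Carrier → List (Carrier × A) → List (Carrier × A)
    scale p = map (map₁ (p *_))

    flat : List (Carrier × Dist A) → List (Carrier × A)
    flat []             = []
    flat ((p , Δ) ∷ es) = scale p (entries Δ) ++ flat es

    sum-++ : ∀ xs ys → sum (xs ++ ys) ≡ sum xs + sum ys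
    sum-++ []       ys = sym (+-identityˡ _)
    sum-++ (x ∷ xs) ys = trans (cong (x +_) (sum-++ xs ys)) (sym (+-assoc x _ _))

    sum-scale : ∀ p (es : List (Carrier × A)) →
                sum (map proj₁ (scale p es)) ≡ p * sum (map proj₁ es)
    sum-scale p []             = sym (zeroʳ p)
    sum-scale p ((q , _) ∷ es) =
      trans (cong (p * q +_) (sum-scale p es)) (sym (distribˡ p q _))

    pos-scale : ∀ {p} → 0# < p → (es : List (Carrier × A)) →
                All (0# <_) (map proj₁ es) → All (0# <_) (map proj₁ (scale p es))
    pos-scale 0<p []       []            = []
    pos-scale 0<p (_ ∷ es) (0<q ∷ 0<qs) = *-pos 0<p 0<q ∷ pos-scale 0<p es 0<qs

    sum-flat : (es : List (Carrier × Dist A)) →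
               sum (map proj₁ (flat es)) ≡ sum (map proj₁ es)
    sum-flat []             = refl
    sum-flat ((p , Δ) ∷ es) = begin
      sum (map proj₁ (scale p (entries Δ) ++ flat es))
        ≡⟨ cong sum (map-++ proj₁ (scale p (entries Δ)) (flat es)) ⟩
      sum (map proj₁ (scale p (entries Δ)) ++ map proj₁ (flat es))
        ≡⟨ sum-++ (map proj₁ (scale p (entries Δ))) _ ⟩
      sum (map proj₁ (scale p (entries Δ))) + sum (map proj₁ (flat es))
        ≡⟨ cong₂ _+_ (sum-scale p (entries Δ)) (sum-flat es) ⟩
      p * sum (map proj₁ (entries Δ)) + sum (map proj₁ es)
        ≡⟨ cong (λ t → p * t + _) (total Δ) ⟩
      p * 1# + sum (map proj₁ es)
        ≡⟨ cong (_+ _) (*-identityʳ p) ⟩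
      p + sum (map proj₁ es) ∎
      where open ≡-Reasoning

    pos-flat : (es : List (Carrier × Dist A)) → All (0# <_) (map proj₁ es) →
               All (0# <_) (map proj₁ (flat es))
    pos-flat []             []            = []
    pos-flat ((p , Δ) ∷ es) (0<p ∷ 0<ps) =
      subst (All (0# <_)) (sym (map-++ proj₁ (scale p (entries Δ)) (flat es)))
        (All.++⁺ (pos-scale 0<p (entries Δ) (positive Δ)) (pos-flat es 0<ps))

  -- Σᵢ pᵢ • Δᵢ ↦ Σᵢ pᵢ Δᵢ
  flatten : Dist (Dist A) → Dist A
  flatten (dist es pos tot) =
    dist (flat es) (pos-flat es pos) (trans (sum-flat es) tot)

  -- Linear lifting of R ⊆ A × B: Δ = Σᵢ pᵢ • aᵢ and Θ = Σᵢ pᵢ • bᵢ for some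
  -- decomposition with aᵢ R bᵢ for all i.
  Lift : (A → B → Set) → Dist A → Dist B → Set
  Lift R Δ Θ = Σ (Dist (∃₂ R)) λ Ξ →
    mapD proj₁ Ξ ≈ Δ × mapD (proj₁ ∘ proj₂) Ξ ≈ Θ

  -- Linear lifting of R ⊆ A × Dist B: Δ = Σᵢ pᵢ • aᵢ and Θ = Σᵢ pᵢ Θᵢ for some
  -- decomposition with aᵢ R Θᵢ for all i.
  LiftD : (A → Dist B → Set) → Dist A → Dist B → Set
  LiftD R Δ Θ = Σ (Dist (∃₂ R)) λ Ξ →
    mapD proj₁ Ξ ≈ Δ × flatten (mapD (proj₁ ∘ proj₂) Ξ) ≈ Θ

-- Matrices over ℂ, density operators, superoperators and measurements.
module Quantum (ℝ : Reals) where

  open Reals ℝ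

  record ℂ : Set where
    constructor _+i_
    field re im : Carrier

  open ℂ public

  0ℂ 1ℂ : ℂ
  0ℂ = 0# +i 0#
  1ℂ = 1# +i 0#

  infixl 6 _+ℂ_
  infixl 7 _*ℂ_

  _+ℂ_ _*ℂ_ : ℂ → ℂ → ℂ
  (a +i b) +ℂ (c +i d) = (a + c) +i (b + d)
  (a +i b) *ℂ (c +i d) = (a * c + - (b * d)) +i (a * d + b * c)

  conj : ℂ → ℂ
  conj (a +i b) = a +i (- b)

  ∑ : ∀ {n} → (Fin n → ℂ) → ℂ
  ∑ = Functional.foldr _+ℂ_ 0ℂ

  Mat : ℕ → Set
  Mat d = Vec (Vec ℂ d) d

  private variable d k n N : ℕ

  _⟨_,_⟩ : Mat d → Fin d → Fin d → ℂ
  A ⟨ i , j ⟩ = lookup (lookup A i) j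

  matrix : (Fin d → Fin d → ℂ) → Mat d
  matrix f = tabulate λ i → tabulate (f i)

  infixl 6 _⊞_
  infixl 7 _·_
  infixl 7 _•_
  infix  8 _†

  𝟎 𝟏 : Mat d
  𝟎 = matrix λ _ _ → 0ℂ
  𝟏 = matrix λ i j → if does (i Fin.≟ j) then 1ℂ else 0ℂ

  _⊞_ _·_ : Mat d → Mat d → Mat d
  A ⊞ B = matrix λ i j → A ⟨ i , j ⟩ +ℂ B ⟨ i , j ⟩
  A · B = matrix λ i j → ∑ λ l → A ⟨ i , l ⟩ *ℂ B ⟨ l , j ⟩

  _•_ : Carrier → Mat d → Mat d
  p • A = matrix λ i j → (p +i 0#) *ℂ A ⟨ i , j ⟩

  _† : Mat d → Mat d
  A † = matrix λ i j → conj (A ⟨ j , i ⟩)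

  trace : Mat d → ℂ
  trace A = ∑ λ i → A ⟨ i , i ⟩

  ∑ᴹ : List (Mat d) → Mat d
  ∑ᴹ = foldr _⊞_ 𝟎

  record IsDensity (A : Mat d) : Set where
    field
      hermitian : A † ≡ A
      psd       : (v : Fin d → ℂ) →
                  0# ≤ re (∑ λ i → ∑ λ j → conj (v i) *ℂ A ⟨ i , j ⟩ *ℂ v j)
      trace-one : trace A ≡ 1ℂ

  -- In the next three records the axioms are irrelevant, so that equality is
  -- equality of the underlying matrices.

  -- Density operators on N qubits.
  record Density (N : ℕ) : Set where
    constructor density
    field
      mat        : Mat (2 ^ N)
      .isDensity : IsDensity mat

  -- Trace-preserving superoperators on n qubits, in Kraus form.
  record SuperOp (n : ℕ) : Set where
    field
      kraus     : List (Mat (2 ^ n))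
      .complete : ∑ᴹ (map (λ K → K † · K) kraus) ≡ 𝟏

  -- Measurements of n qubits with outcomes 0, …, k - 1.
  record Measurement (n k : ℕ) : Set where
    field
      ops       : Vec (Mat (2 ^ n)) k
      .complete : ∑ᴹ (map (λ M → M † · M) (Vec.toList ops)) ≡ 𝟏

  open Density public
  open SuperOp public
  open Measurement public

  -- The basis states of N qubits are indexed by Fin (2 ^ N), read through
  -- finToFun as bit strings Fin N → Fin 2.

  -- The bits of s at the positions q.
  pick : Vec (Fin N) n → Fin (2 ^ N) → Fin (2 ^ n)
  pick q s = funToFin (λ j → finToFun s (lookup q j))

  AgreeOff : Vec (Fin N) n → (s t : Fin (2 ^ N)) → Set
  AgreeOff q s t = ∀ i → i ∈ᵛ q ⊎ finToFun {2} s i ≡ finToFun t i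
    where open VecMembership Fin._≟_ using () renaming (_∈_ to _∈ᵛ_)

  agreeOff? : (q : Vec (Fin N) n) (s t : Fin (2 ^ N)) → Dec (AgreeOff q s t)
  agreeOff? q s t =
    Fin.all? λ i → (i ∈ᵛ? q) ⊎-dec (finToFun {2} s i Fin.≟ finToFun t i)
    where open VecMembership Fin._≟_ using () renaming (_∈?_ to _∈ᵛ?_)

  -- K acting on the qubits q, tensored with the identity on the other qubits.
  on : Vec (Fin N) n → Mat (2 ^ n) → Mat (2 ^ N)
  on q K = matrix λ s t →
    if does (agreeOff? q s t) then K ⟨ pick q s , pick q t ⟩ else 0ℂ

  sandwich : Mat d → Mat d → Mat d
  sandwich K ρ = K · ρ · K †

  applyOp : SuperOp n → Vec (Fin N) n → Mat (2 ^ N) → Mat (2 ^ N)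
  applyOp 𝓔 q ρ = ∑ᴹ (map (λ K → sandwich (on q K) ρ) (kraus 𝓔))

  unnormalised : Measurement n k → Vec (Fin N) n → Density N → Fin k → Mat (2 ^ N)
  unnormalised 𝕄 q ρ m = sandwich (on q (lookup (ops 𝕄) m)) (mat ρ)

  prob : Measurement n k → Vec (Fin N) n → Density N → Fin k → Carrier
  prob 𝕄 q ρ m = re (trace (unnormalised 𝕄 q ρ m))

-- The calculus, over a system of N qubits.
module LqCCS (em : ExcludedMiddle 0ℓ) (ℝ : Reals) (N : ℕ) where

  open Reals ℝ using (Carrier; 0#; _≟_)
  open Distributions em ℝ public
  open Quantum ℝ public

  data Ty : Set where
    nat bool qubit : Ty

  Val : Ty → Set
  Val nat   = ℕ
  Val bool  = Bool
  Val qubit = Fin N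

  record Chan : Set where
    constructor chan
    field
      name : ℕ
      sort : Ty

  open Chan public

  Ctx : Set
  Ctx = List Ty

  private variable
    Γ Γ′ : Ctx
    T    : Ty
    n k  : ℕ

  data Expr (Γ : Ctx) : Ty → Set where
    var  : T ∈ Γ → Expr Γ T
    val  : Val T → Expr Γ T
    notᵉ : Expr Γ bool → Expr Γ bool
    _∨ᵉ_ : Expr Γ bool → Expr Γ bool → Expr Γ bool
    _≤ᵉ_ : Expr Γ nat → Expr Γ nat → Expr Γ bool

  eval : Expr [] T → Val T
  eval (val v)   = v
  eval (notᵉ e)  = not (eval e)
  eval (e ∨ᵉ e′) = eval e ∨ eval e′
  eval (e ≤ᵉ e′) = eval e ≤ᵇ eval e′

  infixr 5 _⊕_
  infixr 6 _∥_
  infix  7 _∖_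

  -- Binders (of measurement outcomes and received values) are de Bruijn.
  data Proc (Γ : Ctx) : Set where
    nil           : List (Expr Γ qubit) → Proc Γ
    tau           : Proc Γ → Proc Γ
    op            : SuperOp n → Vec (Expr Γ qubit) n → Proc Γ → Proc Γ
    meas          : Measurement n k → Vec (Expr Γ qubit) n → Proc (nat ∷ Γ) → Proc Γ
    recv          : (c : Chan) → Proc (sort c ∷ Γ) → Proc Γ
    send          : (c : Chan) → Expr Γ (sort c) → Proc Γ
    if_then_else′_ : Expr Γ bool → Proc Γ → Proc Γ → Proc Γ
    _⊕_           : Proc Γ → Proc Γ → Proc Γ
    _∥_           : Proc Γ → Proc Γ → Proc Γ
    _∖_           : Proc Γ → Chan → Proc Γ

  -- Observers have neither sums, nor restriction, nor silent prefixes.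
  data Obs (Γ : Ctx) : Set where
    nil           : List (Expr Γ qubit) → Obs Γ
    op            : SuperOp n → Vec (Expr Γ qubit) n → Obs Γ → Obs Γ
    meas          : Measurement n k → Vec (Expr Γ qubit) n → Obs (nat ∷ Γ) → Obs Γ
    recv          : (c : Chan) → Obs (sort c ∷ Γ) → Obs Γ
    send          : (c : Chan) → Expr Γ (sort c) → Obs Γ
    if_then_else′_ : Expr Γ bool → Obs Γ → Obs Γ → Obs Γ
    _∥_           : Obs Γ → Obs Γ → Obs Γ

  Sub : Ctx → Ctx → Set
  Sub Γ Γ′ = ∀ {T} → T ∈ Γ → Expr Γ′ T

  subᵉ : Sub Γ Γ′ → Expr Γ T → Expr Γ′ T
  subᵉ σ (var x)   = σ x
  subᵉ σ (val v)   = val v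
  subᵉ σ (notᵉ e)  = notᵉ (subᵉ σ e)
  subᵉ σ (e ∨ᵉ e′) = subᵉ σ e ∨ᵉ subᵉ σ e′
  subᵉ σ (e ≤ᵉ e′) = subᵉ σ e ≤ᵉ subᵉ σ e′

  lift : Sub Γ Γ′ → Sub (T ∷ Γ) (T ∷ Γ′)
  lift σ (here eq) = var (here eq)
  lift σ (there x) = subᵉ (λ y → var (there y)) (σ x)

  sub : Sub Γ Γ′ → Proc Γ → Proc Γ′
  sub σ (nil es)                = nil (map (subᵉ σ) es)
  sub σ (tau P)                 = tau (sub σ P)
  sub σ (op 𝓔 es P)             = op 𝓔 (Vec.map (subᵉ σ) es) (sub σ P)
  sub σ (meas 𝕄 es P)           = meas 𝕄 (Vec.map (subᵉ σ) es) (sub (lift σ) P)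
  sub σ (recv c P)              = recv c (sub (lift σ) P)
  sub σ (send c e)              = send c (subᵉ σ e)
  sub σ (if e then P else′ Q)   = if subᵉ σ e then sub σ P else′ sub σ Q
  sub σ (P ⊕ Q)                 = sub σ P ⊕ sub σ Q
  sub σ (P ∥ Q)                 = sub σ P ∥ sub σ Q
  sub σ (P ∖ c)                 = sub σ P ∖ c

  subᵒ : Sub Γ Γ′ → Obs Γ → Obs Γ′
  subᵒ σ (nil es)               = nil (map (subᵉ σ) es)
  subᵒ σ (op 𝓔 es R)            = op 𝓔 (Vec.map (subᵉ σ) es) (subᵒ σ R)
  subᵒ σ (meas 𝕄 es R)          = meas 𝕄 (Vec.map (subᵉ σ) es) (subᵒ (lift σ) R)
  subᵒ σ (recv c R)             = recv c (subᵒ (lift σ) R)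
  subᵒ σ (send c e)             = send c (subᵉ σ e)
  subᵒ σ (if e then R else′ S)  = if subᵉ σ e then subᵒ σ R else′ subᵒ σ S
  subᵒ σ (R ∥ S)                = subᵒ σ R ∥ subᵒ σ S

  instantiate : Val T → Sub (T ∷ Γ) Γ
  instantiate v (here refl) = val v
  instantiate v (there x)   = var x

  _[_] : Proc (T ∷ []) → Val T → Proc []
  P [ v ] = sub (instantiate v) P

  _[_]ᵒ : Obs (T ∷ []) → Val T → Obs []
  R [ v ]ᵒ = subᵒ (instantiate v) R

  qubits : Vec (Expr [] qubit) n → Vec (Fin N) n
  qubits = Vec.map eval

  -- The two quantum steps are given as relations, which saves proving that
  -- their results are again density operators and distributions.  Distinctness
  -- of the qubits q is required for the operations on q to make sense.

  data _⊢_on_⇓_ (ρ : Density N) (𝓔 : SuperOp n) (q : Vec (Fin N) n)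
                (ρ′ : Density N) : Set where
    applied : Unique q → mat ρ′ ≡ applyOp 𝓔 q (mat ρ) → ρ ⊢ 𝓔 on q ⇓ ρ′

  -- Outcome m has probability pₘ = tr(Mₘ ρ Mₘ†) and leaves the state
  -- ρₘ = Mₘ ρ Mₘ† / pₘ; outcomes of probability zero are discarded.
  data _⊢_measures_⇓_ (ρ : Density N) (𝕄 : Measurement n k) (q : Vec (Fin N) n)
                      (Δ : Dist (Fin k × Density N)) : Set where
    measured :
      Unique q →
      Pointwise
        (λ m (p , m′ , ρₘ) →
          m′ ≡ m × p ≡ prob 𝕄 q ρ m × p • mat ρₘ ≡ unnormalised 𝕄 q ρ m)
        (filter (λ m → ¬? (prob 𝕄 q ρ m ≟ 0#)) (allFin k))
        (entries Δ) →
      ρ ⊢ 𝕄 measures q ⇓ Δ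

  data Act : Set where
    _!_ _⁇_ : (c : Chan) → Val (sort c) → Act

  subject : Act → Chan
  subject (c ! _) = c
  subject (c ⁇ _) = c

  infix 4 _—[_]→_ _⟶_ _⇝[_]_ _⇝⊥[_]_ _⇝⟨_⟩_ _⪯_ _⪯ᶜ_ _⪯ᴰ_

  -- The offers of output and input by a process.  They replace structural
  -- congruence in _⟶_ and _⇝[_]_: a communication may involve components at any
  -- depth, including unguarded summands, and reductions never rearrange terms.
  data _—[_]→_ : Proc [] → Act → Proc [] → Set where
    send  : ∀ {c e} → send c e —[ c ! eval e ]→ nil []
    recv  : ∀ {c P} v → recv c P —[ c ⁇ v ]→ P [ v ]
    then′ : ∀ {α e P Q P′} → eval e ≡ true → P —[ α ]→ P′ →
            if e then P else′ Q —[ α ]→ P′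
    else′ : ∀ {α e P Q Q′} → eval e ≡ false → Q —[ α ]→ Q′ →
            if e then P else′ Q —[ α ]→ Q′
    sumˡ  : ∀ {α P Q P′} → P —[ α ]→ P′ → P ⊕ Q —[ α ]→ P′
    sumʳ  : ∀ {α P Q Q′} → Q —[ α ]→ Q′ → P ⊕ Q —[ α ]→ Q′
    parˡ  : ∀ {α P Q P′} → P —[ α ]→ P′ → P ∥ Q —[ α ]→ P′ ∥ Q
    parʳ  : ∀ {α P Q Q′} → Q —[ α ]→ Q′ → P ∥ Q —[ α ]→ P ∥ Q′
    res   : ∀ {α P P′ c} → subject α ≢ c → P —[ α ]→ P′ → P ∖ c —[ α ]→ P′ ∖ c

  Conf : Set
  Conf = Density N × Proc []

  -- Probabilistic reduction.
  data _⟶_ : Conf → Dist Conf → Set where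
    tau   : ∀ {ρ P} → (ρ , tau P) ⟶ point (ρ , P)
    op    : ∀ {ρ ρ′ P} {𝓔 : SuperOp n} {es} → ρ ⊢ 𝓔 on qubits es ⇓ ρ′ →
            (ρ , op 𝓔 es P) ⟶ point (ρ′ , P)
    meas  : ∀ {ρ P} {𝕄 : Measurement n k} {es Δ} → ρ ⊢ 𝕄 measures qubits es ⇓ Δ →
            (ρ , meas 𝕄 es P) ⟶ mapD (λ (m , ρₘ) → ρₘ , P [ toℕ m ]) Δ
    comˡ  : ∀ {ρ P Q P′ Q′ c v} → P —[ c ! v ]→ P′ → Q —[ c ⁇ v ]→ Q′ →
            (ρ , P ∥ Q) ⟶ point (ρ , P′ ∥ Q′)
    comʳ  : ∀ {ρ P Q P′ Q′ c v} → P —[ c ⁇ v ]→ P′ → Q —[ c ! v ]→ Q′ →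
            (ρ , P ∥ Q) ⟶ point (ρ , P′ ∥ Q′)
    then′ : ∀ {ρ e P Q Δ} → eval e ≡ true → (ρ , P) ⟶ Δ →
            (ρ , if e then P else′ Q) ⟶ Δ
    else′ : ∀ {ρ e P Q Δ} → eval e ≡ false → (ρ , Q) ⟶ Δ →
            (ρ , if e then P else′ Q) ⟶ Δ
    sumˡ  : ∀ {ρ P Q Δ} → (ρ , P) ⟶ Δ → (ρ , P ⊕ Q) ⟶ Δ
    sumʳ  : ∀ {ρ P Q Δ} → (ρ , Q) ⟶ Δ → (ρ , P ⊕ Q) ⟶ Δ
    parˡ  : ∀ {ρ P Q Δ} → (ρ , P) ⟶ Δ → (ρ , P ∥ Q) ⟶ mapD (map₂ (_∥ Q)) Δ
    parʳ  : ∀ {ρ P Q Δ} → (ρ , Q) ⟶ Δ → (ρ , P ∥ Q) ⟶ mapD (map₂ (P ∥_)) Δ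
    res   : ∀ {ρ P Δ c} → (ρ , P) ⟶ Δ → (ρ , P ∖ c) ⟶ mapD (map₂ (_∖ c)) Δ

  data ExtConf : Set where
    ⟪_,_,_⟫ : Density N → Proc [] → Obs [] → ExtConf
    ⊥       : ExtConf

  data Dir : Set where
    ℓ r : Dir

  data Index : Set where
    ⋄   : Index
    obs : List Dir → Index

  mapObs : (Obs [] → Obs []) → ExtConf → ExtConf
  mapObs f ⟪ ρ , P , R ⟫ = ⟪ ρ , P , f R ⟫
  mapObs f ⊥             = ⊥

  -- Enhanced semantics.
  data _⇝[_]_ : ExtConf → Index → Dist ExtConf → Set where
    proc  : ∀ {ρ P R Δ} → (ρ , P) ⟶ Δ →
            ⟪ ρ , P , R ⟫ ⇝[ ⋄ ] mapD (λ (ρ′ , P′) → ⟪ ρ′ , P′ , R ⟫) Δ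
    op    : ∀ {ρ ρ′ P R} {𝓔 : SuperOp n} {es} → ρ ⊢ 𝓔 on qubits es ⇓ ρ′ →
            ⟪ ρ , P , op 𝓔 es R ⟫ ⇝[ obs [] ] point ⟪ ρ′ , P , R ⟫
    meas  : ∀ {ρ P R} {𝕄 : Measurement n k} {es Δ} →
            ρ ⊢ 𝕄 measures qubits es ⇓ Δ →
            ⟪ ρ , P , meas 𝕄 es R ⟫ ⇝[ obs [] ]
              mapD (λ (m , ρₘ) → ⟪ ρₘ , P , R [ toℕ m ]ᵒ ⟫) Δ
    recv  : ∀ {ρ P P′ c v R} → P —[ c ! v ]→ P′ →
            ⟪ ρ , P , recv c R ⟫ ⇝[ obs [] ] point ⟪ ρ , P′ , R [ v ]ᵒ ⟫
    send  : ∀ {ρ P P′ c e} → P —[ c ⁇ eval e ]→ P′ →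
            ⟪ ρ , P , send c e ⟫ ⇝[ obs [] ] point ⟪ ρ , P′ , nil [] ⟫
    then′ : ∀ {ρ P e R S π Δ} → eval e ≡ true → ⟪ ρ , P , R ⟫ ⇝[ obs π ] Δ →
            ⟪ ρ , P , if e then R else′ S ⟫ ⇝[ obs π ] Δ
    else′ : ∀ {ρ P e R S π Δ} → eval e ≡ false → ⟪ ρ , P , S ⟫ ⇝[ obs π ] Δ →
            ⟪ ρ , P , if e then R else′ S ⟫ ⇝[ obs π ] Δ
    parˡ  : ∀ {ρ P R S π Δ} → ⟪ ρ , P , R ⟫ ⇝[ obs π ] Δ →
            ⟪ ρ , P , R ∥ S ⟫ ⇝[ obs (ℓ ∷ π) ] mapD (mapObs (_∥ S)) Δ
    parʳ  : ∀ {ρ P R S π Δ} → ⟪ ρ , P , S ⟫ ⇝[ obs π ] Δ →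
            ⟪ ρ , P , R ∥ S ⟫ ⇝[ obs (r ∷ π) ] mapD (mapObs (R ∥_)) Δ

  data _⇝⊥[_]_ (C : ExtConf) (π : Index) : Dist ExtConf → Set where
    move  : ∀ {Θ} → C ⇝[ π ] Θ → C ⇝⊥[ π ] Θ
    stuck : (∀ Θ → ¬ C ⇝[ π ] Θ) → C ⇝⊥[ π ] point ⊥

  _⇝⟨_⟩_ : Dist ExtConf → Index → Dist ExtConf → Set
  Δ ⇝⟨ π ⟩ Θ = LiftD (_⇝⊥[ π ]_) Δ Θ

  -- P′ ⪯ P reads "P′ refines P".
  data _⪯_ {Γ : Ctx} : Proc Γ → Proc Γ → Set where
    refl  : ∀ {P} → P ⪯ P
    tau   : ∀ {P′ P} → P′ ⪯ P → tau P′ ⪯ tau P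
    op    : ∀ {P′ P} {𝓔 : SuperOp n} {es} → P′ ⪯ P → op 𝓔 es P′ ⪯ op 𝓔 es P
    meas  : ∀ {P′ P} {𝕄 : Measurement n k} {es} → P′ ⪯ P →
            meas 𝕄 es P′ ⪯ meas 𝕄 es P
    recv  : ∀ {c P′ P} → P′ ⪯ P → recv c P′ ⪯ recv c P
    cond  : ∀ {e P′ P Q′ Q} → P′ ⪯ P → Q′ ⪯ Q →
            if e then P′ else′ Q′ ⪯ if e then P else′ Q
    plus  : ∀ {P′ P Q′ Q} → P′ ⪯ P → Q′ ⪯ Q → P′ ⊕ Q′ ⪯ P ⊕ Q
    par   : ∀ {P′ P Q′ Q} → P′ ⪯ P → Q′ ⪯ Q → P′ ∥ Q′ ⪯ P ∥ Q
    res   : ∀ {c P′ P} → P′ ⪯ P → P′ ∖ c ⪯ P ∖ c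
    left  : ∀ {P′ P Q} → P′ ⪯ P → P′ ⪯ P ⊕ Q
    right : ∀ {P Q′ Q} → Q′ ⪯ Q → Q′ ⪯ P ⊕ Q
    split : ∀ {e P′ P Q′ Q} → P′ ⪯ P → Q′ ⪯ Q → if e then P′ else′ Q′ ⪯ P ⊕ Q

  data _⪯ᶜ_ : ExtConf → ExtConf → Set where
    process  : ∀ {ρ P′ P R} → P′ ⪯ P → ⟪ ρ , P′ , R ⟫ ⪯ᶜ ⟪ ρ , P , R ⟫
    deadlock : ∀ {C} → ⊥ ⪯ᶜ C

  _⪯ᴰ_ : Dist ExtConf → Dist ExtConf → Set
  _⪯ᴰ_ = Lift _⪯ᶜ_

{-# OPTIONS --safe #-}

-- The heart of the proof is a simulation: if P′ ⪯ P, every move of P′ is matched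
-- by a move of P with the same label whose outcomes have the same weights and are
-- refined entry by entry.  A stuck C′ goes to ⊥, which refines whatever C does.
--
-- To lift this to distributions, the decomposition of Δ′ that witnesses
-- Δ′ ⪯ Δ must be reconciled with the one that witnesses Δ′ ⇝ Θ′.  They are glued
-- into a distribution on pairs (x , y) of parts lying over the same configuration
-- a of Δ′, with weight pₓ q_y / Δ′(a).  It has both decompositions as marginals,
-- and each pair carries an instance of the simulation; Θ is the resulting mixture.
module Submission where

open import Algebra.Bundles using (CommutativeRing)
import Algebra.Properties.Ring as RingProperties
open import Axiom.ExcludedMiddle using (ExcludedMiddle)
open import Data.Bool using (if_then_else_; true; false)
open import Data.Empty using (⊥-elim)
open import Data.Fin using (toℕ)
open import Data.List using (List; []; _∷_; _++_; map; concatMap)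
open import Data.List.Membership.Propositional using (_∈_)
open import Data.List.Properties using (map-∘)
open import Data.List.Relation.Binary.Pointwise as Pointwise using (Pointwise; []; _∷_)
open import Data.List.Relation.Unary.All as All using (All; []; _∷_)
import Data.List.Relation.Unary.All.Properties as All
open import Data.List.Relation.Unary.Any using (here; there)
open import Data.Nat using (ℕ)
open import Data.Product using (Σ; ∃; ∃₂; _×_; _,_; proj₁; proj₂; map₁; map₂)
import Data.Product.Relation.Binary.Pointwise.NonDependent as Product
open import Data.Sum using (inj₁; inj₂)
open import Function using (_∘_)
open import Level using (0ℓ)
open import Relation.Binary.Definitions using (tri<; tri≈; tri>)
open import Relation.Binary.PropositionalEquality
  using (_≡_; _≢_; refl; sym; trans; cong; cong₂; subst; subst₂; module ≡-Reasoning)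
open import Relation.Binary.Structures using (IsStrictTotalOrder)
open import Relation.Nullary using (Dec; yes; no; does)
open import Relation.Nullary.Decidable using (dec-true; dec-false)
open import Defs

-- Positivity in an ordered field.

module OrderedField (ℝ : Reals) where

  open Reals ℝ

  commutativeRing : CommutativeRing 0ℓ 0ℓ
  commutativeRing = record { isCommutativeRing = isCommutativeRing }

  open CommutativeRing commutativeRing public
    using (ring; *-assoc; *-comm; *-identityˡ; zeroˡ; +-comm; -‿inverseˡ; -‿inverseʳ)
  open RingProperties ring using (-‿distribʳ-*)
  open IsStrictTotalOrder isStrictTotalOrder public
    using (compare; irrefl; asym) renaming (trans to <-trans)

  0<x⇒x≢0 : ∀ {x} → 0# < x → x ≢ 0#
  0<x⇒x≢0 0<x x≡0 = irrefl (sym x≡0) 0<x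

  x<0⇒0<-x : ∀ {x} → x < 0# → 0# < - x
  x<0⇒0<-x {x} x<0 = subst₂ _<_ (-‿inverseˡ x) (+-identityʳ (- x)) (+-monoʳ-< (- x) x<0)

  -- By trichotomy: `y ≡ 0#` would give `0# ≡ 1#`, and `y < 0#` would make `x * - y`, that is
  -- `- 1#`, positive, whence `1# < 0#`.
  inverse-pos : ∀ {x y} → 0# < x → x * y ≡ 1# → 0# < y
  inverse-pos {x} {y} 0<x xy≡1 with compare 0# y
  ... | tri< 0<y _ _ = 0<y
  ... | tri≈ _ 0≡y _ =
    ⊥-elim (irrefl (trans (sym (zeroʳ x)) (trans (cong (x *_) 0≡y) xy≡1)) 0<1)
  ... | tri> _ _ y<0 = ⊥-elim (asym 0<1 (subst₂ _<_ (+-identityʳ 1#) (-‿inverseʳ 1#)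
                                        (+-monoʳ-< 1# 0<-1)))
    where
    0<-1 : 0# < - 1#
    0<-1 = subst (0# <_) (trans (sym (-‿distribʳ-* x y)) (cong -_ xy≡1))
             (*-pos 0<x (x<0⇒0<-x y<0))

  +-pos-nonneg : ∀ {x y} → 0# < x → 0# ≤ y → 0# < x + y
  +-pos-nonneg {x} 0<x (inj₁ 0<y) =
    <-trans 0<x (subst (_< x + _) (+-identityʳ x) (+-monoʳ-< x 0<y))
  +-pos-nonneg {x} 0<x (inj₂ refl) = subst (0# <_) (sym (+-identityʳ x)) 0<x

  +-nonneg : ∀ {x y} → 0# ≤ x → 0# ≤ y → 0# ≤ x + y
  +-nonneg (inj₁ 0<x) 0≤y = inj₁ (+-pos-nonneg 0<x 0≤y)
  +-nonneg (inj₂ refl) 0≤y = subst (0# ≤_) (sym (+-identityˡ _)) 0≤y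

  *-nonneg : ∀ {x y} → 0# < x → 0# ≤ y → 0# ≤ x * y
  *-nonneg 0<x (inj₁ 0<y) = inj₁ (*-pos 0<x 0<y)
  *-nonneg {x} 0<x (inj₂ refl) = inj₂ (sym (zeroʳ x))

  x*yz≡y*xz : ∀ x y z → x * (y * z) ≡ y * (x * z)
  x*yz≡y*xz x y z =
    trans (sym (*-assoc x y z)) (trans (cong (_* z) (*-comm x y)) (*-assoc y x z))

-- Weighted sums of test functions.

module Expectation (em : ExcludedMiddle 0ℓ) (ℝ : Reals) where

  open Reals ℝ
  open OrderedField ℝ
  open Distributions em ℝ
  open ≡-Reasoning

  private variable
    A B X Y : Set

  Weighted : Set → Set
  Weighted A = List (Carrier × A)

  -- The expected value of `φ`, without asking that the weights be normalised. Masses, totals and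
  -- mixtures are all instances, so equations between distributions reduce to linearity of `𝔼` in
  -- the test function.
  𝔼 : Weighted A → (A → Carrier) → Carrier
  𝔼 es φ = sum (map (λ (p , x) → p * φ x) es)

  δ : A → A → Carrier
  δ x a = if does (em {x ≡ a}) then 1# else 0#

  δ-refl : (a : A) → δ a a ≡ 1#
  δ-refl a = cong (if_then 1# else 0#) (dec-true em refl)

  δ-sym : (x a : A) → δ x a ≡ δ a x
  δ-sym x a with em {x ≡ a}
  ... | yes refl = sym (δ-refl x)
  ... | no x≢a   = cong (if_then 1# else 0#) (sym (dec-false em (x≢a ∘ sym)))

  δ-nonneg : (x a : A) → 0# ≤ δ x a
  δ-nonneg x a with does (em {x ≡ a})
  ... | true  = inj₁ 0<1
  ... | false = inj₂ refl

  -- Off the diagonal both sides vanish. This turns a factor that varies with the summation variable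
  -- into a constant that can be pulled out of the sum.
  δ-replace : (w : A → Carrier) (x a : A) → w x * δ x a ≡ w a * δ x a
  δ-replace w x a with em {x ≡ a}
  ... | yes refl = refl
  ... | no _     = trans (zeroʳ _) (sym (zeroʳ _))

  -- Membership is available to the pointwise equation because cancelling a reciprocal is justified
  -- only at actual entries, where the mass is positive.
  𝔼-cong-∈ : (es : Weighted A) {φ ψ : A → Carrier} →
             (∀ {p x} → (p , x) ∈ es → φ x ≡ ψ x) → 𝔼 es φ ≡ 𝔼 es ψ
  𝔼-cong-∈ []             eq = refl
  𝔼-cong-∈ ((p , x) ∷ es) eq =
    cong₂ _+_ (cong (p *_) (eq (here refl))) (𝔼-cong-∈ es (eq ∘ there))

  𝔼-cong : (es : Weighted A) {φ ψ : A → Carrier} → (∀ x → φ x ≡ ψ x) → 𝔼 es φ ≡ 𝔼 es ψ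
  𝔼-cong es eq = 𝔼-cong-∈ es (λ {_} {x} _ → eq x)

  𝔼-++ : (es fs : Weighted A) (φ : A → Carrier) → 𝔼 (es ++ fs) φ ≡ 𝔼 es φ + 𝔼 fs φ
  𝔼-++ []       fs φ = sym (+-identityˡ _)
  𝔼-++ (e ∷ es) fs φ = trans (cong (_ +_) (𝔼-++ es fs φ)) (sym (+-assoc _ _ _))

  𝔼-map : (f : A → B) (es : Weighted A) (φ : B → Carrier) →
          𝔼 (map (map₂ f) es) φ ≡ 𝔼 es (φ ∘ f)
  𝔼-map f es φ = cong sum (sym (map-∘ es))

  𝔼-scale : (c : Carrier) (es : Weighted A) (φ : A → Carrier) →
            𝔼 (map (map₁ (c *_)) es) φ ≡ c * 𝔼 es φ
  𝔼-scale c []             φ = sym (zeroʳ c)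
  𝔼-scale c ((p , x) ∷ es) φ =
    trans (cong₂ _+_ (*-assoc c p (φ x)) (𝔼-scale c es φ)) (sym (distribˡ c _ _))

  𝔼-*ˡ : (c : Carrier) (es : Weighted A) (φ : A → Carrier) →
         𝔼 es (λ x → c * φ x) ≡ c * 𝔼 es φ
  𝔼-*ˡ c []             φ = sym (zeroʳ c)
  𝔼-*ˡ c ((p , x) ∷ es) φ =
    trans (cong₂ _+_ (x*yz≡y*xz p c (φ x)) (𝔼-*ˡ c es φ)) (sym (distribˡ c _ _))

  𝔼-*ʳ : (c : Carrier) (es : Weighted A) (φ : A → Carrier) →
         𝔼 es (λ x → φ x * c) ≡ 𝔼 es φ * c
  𝔼-*ʳ c es φ = begin
    𝔼 es (λ x → φ x * c) ≡⟨ 𝔼-cong es (λ x → *-comm (φ x) c) ⟩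
    𝔼 es (λ x → c * φ x) ≡⟨ 𝔼-*ˡ c es φ ⟩
    c * 𝔼 es φ           ≡⟨ *-comm c _ ⟩
    𝔼 es φ * c           ∎

  𝔼-0 : (es : Weighted A) → 𝔼 es (λ _ → 0#) ≡ 0#
  𝔼-0 []             = refl
  𝔼-0 ((p , _) ∷ es) = trans (cong₂ _+_ (zeroʳ p) (𝔼-0 es)) (+-identityˡ 0#)

  𝔼-+ : (es : Weighted A) (φ ψ : A → Carrier) →
        𝔼 es (λ x → φ x + ψ x) ≡ 𝔼 es φ + 𝔼 es ψ
  𝔼-+ []             φ ψ = sym (+-identityˡ 0#)
  𝔼-+ ((p , x) ∷ es) φ ψ = begin
    p * (φ x + ψ x) + 𝔼 es (λ x → φ x + ψ x)
      ≡⟨ cong₂ _+_ (distribˡ p (φ x) (ψ x)) (𝔼-+ es φ ψ) ⟩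
    (p * φ x + p * ψ x) + (𝔼 es φ + 𝔼 es ψ)
      ≡⟨ interchange (p * φ x) (p * ψ x) (𝔼 es φ) (𝔼 es ψ) ⟩
    (p * φ x + 𝔼 es φ) + (p * ψ x + 𝔼 es ψ) ∎
    where
    open import Algebra.Properties.CommutativeSemigroup
      (CommutativeRing.+-commutativeSemigroup commutativeRing) using (interchange)

  -- Fubini for finite sums.
  𝔼-swap : (es : Weighted A) (fs : Weighted B) (Φ : A → B → Carrier) →
           𝔼 es (λ x → 𝔼 fs (Φ x)) ≡ 𝔼 fs (λ y → 𝔼 es (λ x → Φ x y))
  𝔼-swap []             fs Φ = sym (𝔼-0 fs)
  𝔼-swap ((p , x) ∷ es) fs Φ = begin
    p * 𝔼 fs (Φ x) + 𝔼 es (λ x → 𝔼 fs (Φ x))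
      ≡⟨ cong₂ _+_ (sym (𝔼-*ˡ p fs (Φ x))) (𝔼-swap es fs Φ) ⟩
    𝔼 fs (λ y → p * Φ x y) + 𝔼 fs (λ y → 𝔼 es (λ x → Φ x y))
      ≡⟨ 𝔼-+ fs _ _ ⟨
    𝔼 fs (λ y → p * Φ x y + 𝔼 es (λ x → Φ x y)) ∎

  𝔼-nonneg : {es : Weighted A} {φ : A → Carrier} →
             All (0# <_) (map proj₁ es) → (∀ x → 0# ≤ φ x) → 0# ≤ 𝔼 es φ
  𝔼-nonneg {es = []}    []          0≤φ = inj₂ refl
  𝔼-nonneg {es = _ ∷ _} (0<p ∷ pos) 0≤φ =
    +-nonneg (*-nonneg 0<p (0≤φ _)) (𝔼-nonneg pos 0≤φ)

  𝔼-pos : {es : Weighted A} {φ : A → Carrier} → All (0# <_) (map proj₁ es) →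
          (∀ x → 0# ≤ φ x) → ∀ {p x} → (p , x) ∈ es → 0# < φ x → 0# < 𝔼 es φ
  𝔼-pos (0<p ∷ pos) 0≤φ (here refl) 0<φx =
    +-pos-nonneg (*-pos 0<p 0<φx) (𝔼-nonneg pos 0≤φ)
  𝔼-pos (0<p ∷ pos) 0≤φ (there i)   0<φx =
    subst (0# <_) (+-comm _ _)
      (+-pos-nonneg (𝔼-pos pos 0≤φ i 0<φx) (*-nonneg 0<p (0≤φ _)))

  𝔼-1 : (es : Weighted A) → 𝔼 es (λ _ → 1#) ≡ sum (map proj₁ es)
  𝔼-1 []             = refl
  𝔼-1 ((p , _) ∷ es) = cong₂ _+_ (*-identityʳ p) (𝔼-1 es)

  -- Masses and mixtures as expectations.

  mass≡𝔼 : (Δ : Dist A) (a : A) → mass Δ a ≡ 𝔼 (entries Δ) (λ x → δ x a)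
  mass≡𝔼 Δ a = go (entries Δ)
    where
    go : ∀ es → sum (map (λ (p , x) → if does (em {x ≡ a}) then p else 0#) es) ≡
                𝔼 es (λ x → δ x a)
    go []             = refl
    go ((p , x) ∷ es) with does (em {x ≡ a})
    ... | true  = cong₂ _+_ (sym (*-identityʳ p)) (go es)
    ... | false = cong₂ _+_ (sym (zeroʳ p)) (go es)

  mass-mapD : (f : A → B) (Δ : Dist A) (b : B) →
              mass (mapD f Δ) b ≡ 𝔼 (entries Δ) (λ x → δ (f x) b)
  mass-mapD f Δ b = trans (mass≡𝔼 (mapD f Δ) b) (𝔼-map f (entries Δ) _)

  mixture : Weighted (Dist A) → Weighted A
  mixture = concatMap (λ (p , Δ) → map (map₁ (p *_)) (entries Δ))

  𝔼-mixture : (φ : A → Carrier) (es : Weighted (Dist A)) →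
              𝔼 (mixture es) φ ≡ 𝔼 es (λ Δ → 𝔼 (entries Δ) φ)
  𝔼-mixture φ []             = refl
  𝔼-mixture φ ((p , Δ) ∷ es) =
    trans (𝔼-++ (map (map₁ (p *_)) (entries Δ)) (mixture es) φ)
      (cong₂ _+_ (𝔼-scale p (entries Δ) φ) (𝔼-mixture φ es))

  -- The two recursion equations determine `F` by induction on the list. Keeping `F` abstract allows
  -- the statement to be applied to a function that has no accessible name.
  mixture-unique : (F : Weighted (Dist A) → Weighted A) → F [] ≡ [] →
    (∀ p Δ es → F ((p , Δ) ∷ es) ≡ map (map₁ (p *_)) (entries Δ) ++ F es) →
    (Ξ : Dist (Dist A)) → F (entries Ξ) ≡ mixture (entries Ξ)
  mixture-unique F F[] F∷ Ξ = go (entries Ξ)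
    where
    go : ∀ es → F es ≡ mixture es
    go []             = F[]
    go ((p , Δ) ∷ es) = trans (F∷ p Δ es) (cong (_ ++_) (go es))

  -- The list function inside flatten is private to Defs, so it can be named only by
  -- unification; Ξ must not be in scope of the metavariable.
  entries-flatten : (Ξ : Dist (Dist A)) → entries (flatten Ξ) ≡ mixture (entries Ξ)
  entries-flatten = mixture-unique _ refl (λ _ _ _ → refl)

  𝔼-flatten : (φ : A → Carrier) (Ξ : Dist (Dist A)) →
              𝔼 (entries (flatten Ξ)) φ ≡ 𝔼 (entries Ξ) (λ Δ → 𝔼 (entries Δ) φ)
  𝔼-flatten φ Ξ =
    trans (cong (λ es → 𝔼 es φ) (entries-flatten Ξ)) (𝔼-mixture φ (entries Ξ))

  -- The law of total probability, with `k` as the conditional distribution.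
  mass-flatten : (k : A → Dist B) (Ξ : Dist A) (b : B) →
                 mass (flatten (mapD k Ξ)) b ≡ 𝔼 (entries Ξ) (λ x → mass (k x) b)
  mass-flatten k Ξ b = begin
    mass (flatten (mapD k Ξ)) b
      ≡⟨ mass≡𝔼 (flatten (mapD k Ξ)) b ⟩
    𝔼 (entries (flatten (mapD k Ξ))) (λ x → δ x b)
      ≡⟨ 𝔼-flatten _ (mapD k Ξ) ⟩
    𝔼 (entries (mapD k Ξ)) (λ Δ → 𝔼 (entries Δ) (λ x → δ x b))
      ≡⟨ 𝔼-map k (entries Ξ) _ ⟩
    𝔼 (entries Ξ) (λ x → 𝔼 (entries (k x)) (λ x → δ x b))
      ≡⟨ 𝔼-cong (entries Ξ) (λ x → sym (mass≡𝔼 (k x) b)) ⟩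
    𝔼 (entries Ξ) (λ x → mass (k x) b) ∎

  mass-mapD-flatten : (f : B → Y) (k : A → Dist B) (Ξ : Dist A) (b : Y) →
    mass (mapD f (flatten (mapD k Ξ))) b ≡ 𝔼 (entries Ξ) (λ x → mass (mapD f (k x)) b)
  mass-mapD-flatten f k Ξ b = begin
    mass (mapD f (flatten (mapD k Ξ))) b
      ≡⟨ mass-mapD f (flatten (mapD k Ξ)) b ⟩
    𝔼 (entries (flatten (mapD k Ξ))) (λ x → δ (f x) b)
      ≡⟨ 𝔼-flatten _ (mapD k Ξ) ⟩
    𝔼 (entries (mapD k Ξ)) (λ Δ → 𝔼 (entries Δ) (λ x → δ (f x) b))
      ≡⟨ 𝔼-map k (entries Ξ) _ ⟩
    𝔼 (entries Ξ) (λ x → 𝔼 (entries (k x)) (λ x → δ (f x) b))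
      ≡⟨ 𝔼-cong (entries Ξ) (λ x → sym (mass-mapD f (k x) b)) ⟩
    𝔼 (entries Ξ) (λ x → mass (mapD f (k x)) b) ∎

  -- Made total by the default `0#` at zero, so that `weight` below needs no positivity argument.
  -- The default never enters a cancellation: those happen only where the mass is positive.
  recip : Carrier → Carrier
  recip x with em {x ≡ 0#}
  ... | yes _   = 0#
  ... | no x≢0  = proj₁ (inverse x x≢0)

  recip-inverse : ∀ {x} → 0# < x → x * recip x ≡ 1#
  recip-inverse {x} 0<x with em {x ≡ 0#}
  ... | yes x≡0 = ⊥-elim (0<x⇒x≢0 0<x x≡0)
  ... | no x≢0  = proj₂ (inverse x x≢0)

  -- Gluing two distributions over a common image.

  module Glue (f : X → A) (g : Y → A) (Ξ₁ : Dist X) (Ξ₂ : Dist Y)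
              (f≈g : mapD f Ξ₁ ≈ mapD g Ξ₂) where

    Z : Set
    Z = ∃₂ λ x y → f x ≡ g y

    weight : A → Carrier
    weight a = recip (mass (mapD f Ξ₁) a)

    -- Pairs over different points are dropped, since entries of a `Dist` need positive weight and
    -- elements of `Z` need an equality proof. The decision is an argument so that a case split on
    -- `em` in a proof reduces `row` and `δ` together.
    cell : Carrier → (x : X) (y : Y) → Dec (f x ≡ g y) → Weighted Z → Weighted Z
    cell c x y (yes eq) es = (c , x , y , eq) ∷ es
    cell c x y (no _)   es = es

    row : Carrier → X → Weighted Y → Weighted Z
    row c x []             = []
    row c x ((q , y) ∷ es) = cell (c * q) x y em (row c x es)

    table : Weighted X → Weighted Y → Weighted Z
    table []             fs = []
    table ((p , x) ∷ es) fs = row (p * weight (f x)) x fs ++ table es fs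

    module _ (Φ : X → Y → Carrier) where

      Φ′ : Z → Carrier
      Φ′ (x , y , _) = Φ x y

      -- The dropped cells are exactly those where `δ` is zero, so the partial row becomes a full
      -- sum. This is why `Φ` must be defined on all pairs and not only on `Z`.
      𝔼-row : ∀ c x es → 𝔼 (row c x es) Φ′ ≡ c * 𝔼 es (λ y → δ (f x) (g y) * Φ x y)
      𝔼-row c x []             = sym (zeroʳ c)
      𝔼-row c x ((q , y) ∷ es) with em {f x ≡ g y}
      ... | yes _ = begin
        c * q * Φ x y + 𝔼 (row c x es) Φ′
          ≡⟨ cong₂ _+_ (*-assoc c q _) (𝔼-row c x es) ⟩
        c * (q * Φ x y) + c * R
          ≡⟨ distribˡ c _ _ ⟨
        c * (q * Φ x y + R)
          ≡⟨ cong (λ t → c * (q * t + R)) (*-identityˡ (Φ x y)) ⟨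
        c * (q * (1# * Φ x y) + R) ∎
        where R = 𝔼 es (λ y → δ (f x) (g y) * Φ x y)
      ... | no _ = begin
        𝔼 (row c x es) Φ′
          ≡⟨ 𝔼-row c x es ⟩
        c * R
          ≡⟨ cong (c *_) (+-identityˡ R) ⟨
        c * (0# + R)
          ≡⟨ cong (λ t → c * (t + R)) (zeroʳ q) ⟨
        c * (q * 0# + R)
          ≡⟨ cong (λ t → c * (q * t + R)) (zeroˡ (Φ x y)) ⟨
        c * (q * (0# * Φ x y) + R) ∎
        where R = 𝔼 es (λ y → δ (f x) (g y) * Φ x y)

      𝔼-table : ∀ es fs → 𝔼 (table es fs) Φ′ ≡
        𝔼 es (λ x → weight (f x) * 𝔼 fs (λ y → δ (f x) (g y) * Φ x y))
      𝔼-table []             fs = refl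
      𝔼-table ((p , x) ∷ es) fs =
        trans (𝔼-++ (row (p * weight (f x)) x fs) _ Φ′)
          (cong₂ _+_ (trans (𝔼-row _ x fs) (*-assoc p _ _)) (𝔼-table es fs))

    mass-pos₁ : ∀ {p x} → (p , x) ∈ entries Ξ₁ → 0# < mass (mapD f Ξ₁) (f x)
    mass-pos₁ {x = x} i = subst (0# <_) (sym (mass-mapD f Ξ₁ (f x)))
      (𝔼-pos (positive Ξ₁) (λ _ → δ-nonneg _ _) i (subst (0# <_) (sym (δ-refl (f x))) 0<1))

    mass-pos₂ : ∀ {q y} → (q , y) ∈ entries Ξ₂ → 0# < mass (mapD f Ξ₁) (g y)
    mass-pos₂ {y = y} i =
      subst (0# <_) (sym (trans (f≈g (g y)) (mass-mapD g Ξ₂ (g y))))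
        (𝔼-pos (positive Ξ₂) (λ _ → δ-nonneg _ _) i
          (subst (0# <_) (sym (δ-refl (g y))) 0<1))

    -- For fixed `x`, summing over `y` leaves the mass of `mapD g Ξ₂` at `f x`. By `f≈g` it equals
    -- the mass under `mapD f Ξ₁`, which `weight (f x)` cancels.
    marginal₁ : (h : X → Carrier) →
      𝔼 (table (entries Ξ₁) (entries Ξ₂)) (h ∘ proj₁) ≡ 𝔼 (entries Ξ₁) h
    marginal₁ h =
      trans (𝔼-table (λ x _ → h x) (entries Ξ₁) (entries Ξ₂)) (𝔼-cong-∈ (entries Ξ₁) step)
      where
      step : ∀ {p x} → (p , x) ∈ entries Ξ₁ →
        weight (f x) * 𝔼 (entries Ξ₂) (λ y → δ (f x) (g y) * h x) ≡ h x
      step {x = x} i = begin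
        weight (f x) * 𝔼 (entries Ξ₂) (λ y → δ (f x) (g y) * h x)
          ≡⟨ cong (weight (f x) *_) (𝔼-*ʳ (h x) (entries Ξ₂) _) ⟩
        weight (f x) * (𝔼 (entries Ξ₂) (λ y → δ (f x) (g y)) * h x)
          ≡⟨ cong (λ t → weight (f x) * (t * h x)) inner ⟩
        weight (f x) * (m * h x)
          ≡⟨ x*yz≡y*xz _ m (h x) ⟩
        m * (weight (f x) * h x)
          ≡⟨ *-assoc m _ (h x) ⟨
        m * weight (f x) * h x
          ≡⟨ cong (_* h x) (recip-inverse (mass-pos₁ i)) ⟩
        1# * h x
          ≡⟨ *-identityˡ (h x) ⟩
        h x ∎
        where
        m = mass (mapD f Ξ₁) (f x)
        inner : 𝔼 (entries Ξ₂) (λ y → δ (f x) (g y)) ≡ m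
        inner = begin
          𝔼 (entries Ξ₂) (λ y → δ (f x) (g y)) ≡⟨ 𝔼-cong (entries Ξ₂) (λ y → δ-sym (f x) (g y)) ⟩
          𝔼 (entries Ξ₂) (λ y → δ (g y) (f x)) ≡⟨ mass-mapD g Ξ₂ (f x) ⟨
          mass (mapD g Ξ₂) (f x)               ≡⟨ f≈g (f x) ⟨
          m                                    ∎

    -- The table is built by rows, so the sums are exchanged first. The inner sum over `x` then
    -- yields the mass of `mapD f Ξ₁` at `g y` directly; `f≈g` enters only to show that this mass is
    -- positive.
    marginal₂ : (h : Y → Carrier) →
      𝔼 (table (entries Ξ₁) (entries Ξ₂)) (h ∘ proj₁ ∘ proj₂) ≡ 𝔼 (entries Ξ₂) h
    marginal₂ h = begin
      𝔼 (table (entries Ξ₁) (entries Ξ₂)) (h ∘ proj₁ ∘ proj₂)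
        ≡⟨ 𝔼-table (λ _ → h) (entries Ξ₁) (entries Ξ₂) ⟩
      𝔼 (entries Ξ₁) (λ x → weight (f x) * 𝔼 (entries Ξ₂) (λ y → δ (f x) (g y) * h y))
        ≡⟨ 𝔼-cong (entries Ξ₁) (λ x → 𝔼-*ˡ (weight (f x)) (entries Ξ₂) _) ⟨
      𝔼 (entries Ξ₁) (λ x → 𝔼 (entries Ξ₂) (λ y → weight (f x) * (δ (f x) (g y) * h y)))
        ≡⟨ 𝔼-swap (entries Ξ₁) (entries Ξ₂) _ ⟩
      𝔼 (entries Ξ₂) (λ y → 𝔼 (entries Ξ₁) (λ x → weight (f x) * (δ (f x) (g y) * h y)))
        ≡⟨ 𝔼-cong-∈ (entries Ξ₂) step ⟩
      𝔼 (entries Ξ₂) h ∎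
      where
      step : ∀ {q y} → (q , y) ∈ entries Ξ₂ →
        𝔼 (entries Ξ₁) (λ x → weight (f x) * (δ (f x) (g y) * h y)) ≡ h y
      step {y = y} i = begin
        𝔼 (entries Ξ₁) (λ x → weight (f x) * (δ (f x) (g y) * h y))
          -- The weight depends on `x`, but under `δ (f x) (g y)` it may be read at `g y`, which is
          -- constant in this sum.
          ≡⟨ 𝔼-cong (entries Ξ₁) (λ x → trans (sym (*-assoc _ _ (h y)))
               (cong (_* h y) (δ-replace weight (f x) (g y)))) ⟩
        𝔼 (entries Ξ₁) (λ x → w * δ (f x) (g y) * h y)
          ≡⟨ 𝔼-*ʳ (h y) (entries Ξ₁) _ ⟩
        𝔼 (entries Ξ₁) (λ x → w * δ (f x) (g y)) * h y
          ≡⟨ cong (_* h y) (𝔼-*ˡ w (entries Ξ₁) _) ⟩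
        w * 𝔼 (entries Ξ₁) (λ x → δ (f x) (g y)) * h y
          ≡⟨ cong (λ t → w * t * h y) (mass-mapD f Ξ₁ (g y)) ⟨
        w * mass (mapD f Ξ₁) (g y) * h y
          ≡⟨ cong (_* h y) (trans (*-comm w _) (recip-inverse (mass-pos₂ i))) ⟩
        1# * h y
          ≡⟨ *-identityˡ (h y) ⟩
        h y ∎
        where w = weight (g y)

    row-pos : ∀ {c} x {es} → 0# < c → All ((0# <_) ∘ proj₁) es →
              All ((0# <_) ∘ proj₁) (row c x es)
    row-pos x 0<c []                  = []
    row-pos x {(_ , y) ∷ _} 0<c (0<q ∷ pos) with em {f x ≡ g y}
    ... | yes _ = *-pos 0<c 0<q ∷ row-pos x 0<c pos
    ... | no _  = row-pos x 0<c pos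

    table-pos : ∀ {es fs} → All (λ (p , x) → 0# < p * weight (f x)) es →
                All ((0# <_) ∘ proj₁) fs → All ((0# <_) ∘ proj₁) (table es fs)
    table-pos []          pos₂ = []
    table-pos (0<c ∷ pos) pos₂ = All.++⁺ (row-pos _ 0<c pos₂) (table-pos pos pos₂)

    glued : Dist Z
    glued = dist (table (entries Ξ₁) (entries Ξ₂))
      (All.map⁺ (table-pos (All.tabulate weight-pos) (All.map⁻ (positive Ξ₂))))
      (begin
        sum (map proj₁ (table (entries Ξ₁) (entries Ξ₂)))
          ≡⟨ 𝔼-1 (table (entries Ξ₁) (entries Ξ₂)) ⟨
        𝔼 (table (entries Ξ₁) (entries Ξ₂)) (λ _ → 1#)
          -- The total weight is the first marginal tested against the constant one.
          ≡⟨ marginal₁ (λ _ → 1#) ⟩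
        𝔼 (entries Ξ₁) (λ _ → 1#)
          ≡⟨ 𝔼-1 (entries Ξ₁) ⟩
        sum (map proj₁ (entries Ξ₁))
          ≡⟨ total Ξ₁ ⟩
        1# ∎)
      where
      weight-pos : ∀ {e} → e ∈ entries Ξ₁ → 0# < proj₁ e * weight (f (proj₂ e))
      weight-pos i =
        *-pos (All.lookup (All.map⁻ {f = proj₁} (positive Ξ₁)) i)
          (inverse-pos (mass-pos₁ i) (recip-inverse (mass-pos₁ i)))

  -- Couplings and the lifting of simulations.

  -- A rigid form of `Lift`, with equal weights in the same order, which passes through `mapD`
  -- without any arithmetic. The record keeps `Δ` and `Θ` recoverable from the type; their entries
  -- alone would not determine them.
  record Entrywise (R : A → B → Set) (Δ : Dist A) (Θ : Dist B) : Set where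
    constructor entrywise
    field pairing : Pointwise (Product.Pointwise _≡_ R) (entries Δ) (entries Θ)

  Entrywise-refl : {R : A → A → Set} → (∀ {a} → R a a) → ∀ {Δ} → Entrywise R Δ Δ
  Entrywise-refl r = entrywise (Pointwise.refl (refl , r))

  Entrywise-point : {R : A → B → Set} {a : A} {b : B} → R a b →
                    Entrywise R (point a) (point b)
  Entrywise-point r = entrywise ((refl , r) ∷ [])

  Entrywise-mapD : {R : A → B → Set} {S : X → Y → Set} {f : A → X} {g : B → Y} →
                   (∀ {a b} → R a b → S (f a) (g b)) →
                   ∀ {Δ Θ} → Entrywise R Δ Θ → Entrywise S (mapD f Δ) (mapD g Θ)
  Entrywise-mapD {f = f} {g} r (entrywise rs) =
    entrywise (Pointwise.map⁺ (map₂ f) (map₂ g) (Pointwise.map (map₂ r) rs))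

  zipped : {R : A → B → Set} {es : Weighted A} {fs : Weighted B} →
           Pointwise (Product.Pointwise _≡_ R) es fs →
           Σ (Weighted (∃₂ R)) λ zs →
             map (map₂ proj₁) zs ≡ es × map (map₂ (proj₁ ∘ proj₂)) zs ≡ fs
  zipped []                = [] , refl , refl
  zipped (_∷_ {x = p , a} {y = _ , b} (refl , r) rs) =
    let zs , eq₁ , eq₂ = zipped rs
    in (p , a , b , r) ∷ zs , cong (_ ∷_) eq₁ , cong (_ ∷_) eq₂

  Entrywise⇒Lift : {R : A → B → Set} {Δ : Dist A} {Θ : Dist B} →
                   Entrywise R Δ Θ → Lift R Δ Θ
  Entrywise⇒Lift {Δ = dist _ pos tot} (entrywise rs) with zipped rs
  ... | zs , refl , refl =
    dist zs (subst (All (0# <_)) (sym same) pos) (trans (cong sum same) tot) ,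
    -- `mass` reads only the entries, which now agree definitionally.
    (λ _ → refl) , (λ _ → refl)
    where
    same : map proj₁ zs ≡ map proj₁ (map (map₂ proj₁) zs)
    same = map-∘ zs

  -- The coupling pairs `a` with every entry of `Θ`. Its first marginal is `point a` because the
  -- weights of `Θ` add up to one.
  Lift-point : {R : A → B → Set} {a : A} → (∀ b → R a b) → ∀ Θ → Lift R (point a) Θ
  Lift-point {R = R} {a} r Θ = mapD pair Θ , source , target
    where
    pair : _ → ∃₂ R
    pair b = a , b , r b

    mass-pair : ∀ {C : Set} (f : ∃₂ R → C) c →
                mass (mapD f (mapD pair Θ)) c ≡ 𝔼 (entries Θ) (λ b → δ (f (pair b)) c)
    mass-pair f c = trans (mass-mapD f (mapD pair Θ) c) (𝔼-map pair (entries Θ) _)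

    source : mapD proj₁ (mapD pair Θ) ≈ point a
    source c = begin
      mass (mapD proj₁ (mapD pair Θ)) c
        ≡⟨ mass-pair proj₁ c ⟩
      𝔼 (entries Θ) (λ _ → δ a c)
        ≡⟨ 𝔼-cong (entries Θ) (λ _ → *-identityˡ (δ a c)) ⟨
      𝔼 (entries Θ) (λ _ → 1# * δ a c)
        ≡⟨ 𝔼-*ʳ (δ a c) (entries Θ) _ ⟩
      𝔼 (entries Θ) (λ _ → 1#) * δ a c
        ≡⟨ cong (_* δ a c) (trans (𝔼-1 (entries Θ)) (total Θ)) ⟩
      1# * δ a c
        ≡⟨ +-identityʳ _ ⟨
      1# * δ a c + 0#
        ≡⟨ mass≡𝔼 (point a) c ⟨
      mass (point a) c ∎

    target : mapD (proj₁ ∘ proj₂) (mapD pair Θ) ≈ Θ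
    target c = trans (mass-pair (proj₁ ∘ proj₂) c) (sym (mass≡𝔼 Θ c))

  -- Both decompositions have first components in `A` that distribute as `Δ′`, so they can be glued
  -- there. One choice of matches serves twice: `moves` decomposes `Δ` through the first marginal,
  -- and `witness` recovers `Θ′` through the second.
  LiftD-simulation :
    {R : A → B → Set} {S : A → Dist X → Set} {T : B → Dist Y → Set} {Q : X → Y → Set} →
    (∀ {a b Θ′} → R a b → S a Θ′ → ∃ λ Θ → T b Θ × Lift Q Θ′ Θ) →
    ∀ Δ′ Δ Θ′ → Lift R Δ′ Δ → LiftD S Δ′ Θ′ → ∃ λ Θ → LiftD T Δ Θ × Lift Q Θ′ Θ
  LiftD-simulation {R = R} {S} {T} {Q} sim Δ′ Δ Θ′
    (Ξ₁ , src₁ , tgt₁) (Ξ₂ , src₂ , tgt₂) =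
    flatten (mapD (proj₁ ∘ proj₂) moves) ,
    (moves , moves-source , λ _ → refl) ,
    (flatten (mapD witness glued) , witness-source , witness-target)
    where
    open Glue proj₁ proj₁ Ξ₁ Ξ₂ (λ a → trans (src₁ a) (sym (src₂ a)))

    match : (z : Z) → let (_ , b , _) , (_ , Ψ , _) , _ = z in
            ∃ λ Θ → T b Θ × Lift Q Ψ Θ
    -- The equality stored in `Z` makes `r` and `s` start from the same element, as `sim` requires.
    match ((_ , _ , r) , (_ , _ , s) , refl) = sim r s

    move : Z → ∃₂ T
    move z@((_ , b , _) , _) = b , proj₁ (match z) , proj₁ (proj₂ (match z))

    witness : Z → Dist (∃₂ Q)
    witness z = proj₁ (proj₂ (proj₂ (match z)))

    moves : Dist (∃₂ T)
    moves = mapD move glued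

    moves-source : mapD proj₁ moves ≈ Δ
    moves-source b = begin
      mass (mapD proj₁ moves) b
        ≡⟨ mass-mapD proj₁ moves b ⟩
      𝔼 (entries moves) (λ t → δ (proj₁ t) b)
        ≡⟨ 𝔼-map move (entries glued) _ ⟩
      𝔼 (entries glued) (λ z → δ (proj₁ (proj₂ (proj₁ z))) b)
        ≡⟨ marginal₁ (λ x → δ (proj₁ (proj₂ x)) b) ⟩
      𝔼 (entries Ξ₁) (λ x → δ (proj₁ (proj₂ x)) b)
        ≡⟨ mass-mapD (proj₁ ∘ proj₂) Ξ₁ b ⟨
      mass (mapD (proj₁ ∘ proj₂) Ξ₁) b
        ≡⟨ tgt₁ b ⟩
      mass Δ b ∎

    witness-source : mapD proj₁ (flatten (mapD witness glued)) ≈ Θ′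
    witness-source x = begin
      mass (mapD proj₁ (flatten (mapD witness glued))) x
        ≡⟨ mass-mapD-flatten proj₁ witness glued x ⟩
      𝔼 (entries glued) (λ z → mass (mapD proj₁ (witness z)) x)
        -- The source marginal of each chosen coupling is the `S`-target stored in `z`, so the
        -- integrand now depends on the `Ξ₂` component only.
        ≡⟨ 𝔼-cong (entries glued) (λ z → proj₁ (proj₂ (proj₂ (proj₂ (match z)))) x) ⟩
      𝔼 (entries glued) (λ z → mass (proj₁ (proj₂ (proj₁ (proj₂ z)))) x)
        ≡⟨ marginal₂ (λ y → mass (proj₁ (proj₂ y)) x) ⟩
      𝔼 (entries Ξ₂) (λ y → mass (proj₁ (proj₂ y)) x)
        ≡⟨ mass-flatten (proj₁ ∘ proj₂) Ξ₂ x ⟨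
      mass (flatten (mapD (proj₁ ∘ proj₂) Ξ₂)) x
        ≡⟨ tgt₂ x ⟩
      mass Θ′ x ∎

    witness-target : mapD (proj₁ ∘ proj₂) (flatten (mapD witness glued)) ≈
                     flatten (mapD (proj₁ ∘ proj₂) moves)
    witness-target y = begin
      mass (mapD (proj₁ ∘ proj₂) (flatten (mapD witness glued))) y
        ≡⟨ mass-mapD-flatten (proj₁ ∘ proj₂) witness glued y ⟩
      𝔼 (entries glued) (λ z → mass (mapD (proj₁ ∘ proj₂) (witness z)) y)
        ≡⟨ 𝔼-cong (entries glued) (λ z → proj₂ (proj₂ (proj₂ (proj₂ (match z)))) y) ⟩
      𝔼 (entries glued) (λ z → mass (proj₁ (match z)) y)
        ≡⟨ 𝔼-map move (entries glued) (λ t → mass (proj₁ (proj₂ t)) y) ⟨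
      𝔼 (entries moves) (λ t → mass (proj₁ (proj₂ t)) y)
        ≡⟨ mass-flatten (proj₁ ∘ proj₂) moves y ⟨
      mass (flatten (mapD (proj₁ ∘ proj₂) moves)) y ∎

-- Simulation for processes and configurations.

module Refinement (em : ExcludedMiddle 0ℓ) (ℝ : Reals) (N : ℕ) where

  open LqCCS em ℝ N
  open Expectation em ℝ

  private variable
    Γ Γ′ : Ctx

  -- Needed for input and measurement, whose continuations are refined as open processes and then
  -- instantiated. A guard introduced by `split` may be any expression, so its substituted form is
  -- still allowed.
  sub-⪯ : (σ : Sub Γ Γ′) {P′ P : Proc Γ} → P′ ⪯ P → sub σ P′ ⪯ sub σ P
  sub-⪯ σ refl          = refl
  sub-⪯ σ (tau ref)     = tau (sub-⪯ σ ref)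
  sub-⪯ σ (op ref)      = op (sub-⪯ σ ref)
  sub-⪯ σ (meas ref)    = meas (sub-⪯ (lift σ) ref)
  sub-⪯ σ (recv ref)    = recv (sub-⪯ (lift σ) ref)
  sub-⪯ σ (cond r₁ r₂)  = cond (sub-⪯ σ r₁) (sub-⪯ σ r₂)
  sub-⪯ σ (plus r₁ r₂)  = plus (sub-⪯ σ r₁) (sub-⪯ σ r₂)
  sub-⪯ σ (par r₁ r₂)   = par (sub-⪯ σ r₁) (sub-⪯ σ r₂)
  sub-⪯ σ (res ref)     = res (sub-⪯ σ ref)
  sub-⪯ σ (left ref)    = left (sub-⪯ σ ref)
  sub-⪯ σ (right ref)   = right (sub-⪯ σ ref)
  sub-⪯ σ (split r₁ r₂) = split (sub-⪯ σ r₁) (sub-⪯ σ r₂)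

  -- Induction on the refinement. A discarded summand only removes offers, and a conditional that
  -- replaces a sum acts through one branch, whose offer the corresponding summand also makes,
  -- whatever the guard evaluates to.
  offer-simulation : ∀ {P′ P α S′} → P′ ⪯ P → P′ —[ α ]→ S′ →
                     ∃ λ S → P —[ α ]→ S × S′ ⪯ S
  offer-simulation refl t = _ , t , refl
  offer-simulation (recv ref) (recv v) = _ , recv v , sub-⪯ (instantiate v) ref
  offer-simulation (cond r₁ r₂) (then′ eq t) =
    let _ , u , s = offer-simulation r₁ t in _ , then′ eq u , s
  offer-simulation (cond r₁ r₂) (else′ eq t) =
    let _ , u , s = offer-simulation r₂ t in _ , else′ eq u , s
  offer-simulation (plus r₁ r₂) (sumˡ t) =
    let _ , u , s = offer-simulation r₁ t in _ , sumˡ u , s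
  offer-simulation (plus r₁ r₂) (sumʳ t) =
    let _ , u , s = offer-simulation r₂ t in _ , sumʳ u , s
  offer-simulation (par r₁ r₂) (parˡ t) =
    let _ , u , s = offer-simulation r₁ t in _ , parˡ u , par s r₂
  offer-simulation (par r₁ r₂) (parʳ t) =
    let _ , u , s = offer-simulation r₂ t in _ , parʳ u , par r₁ s
  offer-simulation (res ref) (res α≢c t) =
    let _ , u , s = offer-simulation ref t in _ , res α≢c u , res s
  offer-simulation (left ref) t =
    let _ , u , s = offer-simulation ref t in _ , sumˡ u , s
  offer-simulation (right ref) t =
    let _ , u , s = offer-simulation ref t in _ , sumʳ u , s
  offer-simulation (split r₁ r₂) (then′ _ t) =
    let _ , u , s = offer-simulation r₁ t in _ , sumˡ u , s
  offer-simulation (split r₁ r₂) (else′ _ t) =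
    let _ , u , s = offer-simulation r₂ t in _ , sumʳ u , s

  _⪯ᴾ_ : Conf → Conf → Set
  _⪯ᴾ_ = Product.Pointwise _≡_ _⪯_

  Entrywise-context : {f g : Proc [] → Proc []} → (∀ {P′ P} → P′ ⪯ P → f P′ ⪯ g P) →
                      ∀ {Δ′ Δ} → Entrywise _⪯ᴾ_ Δ′ Δ →
                      Entrywise _⪯ᴾ_ (mapD (map₂ f) Δ′) (mapD (map₂ g) Δ)
  Entrywise-context f⪯g = Entrywise-mapD (map₂ f⪯g)

  -- The same induction. Weights and quantum states coincide because refinement keeps the prefix,
  -- and the quantum step depends only on the prefix and `ρ`.
  ⟶-simulation : ∀ {ρ P′ P Δ′} → P′ ⪯ P → (ρ , P′) ⟶ Δ′ →
                 ∃ λ Δ → (ρ , P) ⟶ Δ × Entrywise _⪯ᴾ_ Δ′ Δ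
  ⟶-simulation refl t = _ , t , Entrywise-refl (refl , refl)
  ⟶-simulation (tau ref) tau = _ , tau , Entrywise-point (refl , ref)
  ⟶-simulation (op ref) (op a) = _ , op a , Entrywise-point (refl , ref)
  ⟶-simulation (meas ref) (meas m) =
    _ , meas m ,
    -- Both targets are images of one outcome distribution, so each outcome is paired with itself
    -- and only the continuations differ.
    Entrywise-mapD (λ { {k , _} refl → refl , sub-⪯ (instantiate (toℕ k)) ref })
      (Entrywise-refl {R = _≡_} refl)
  ⟶-simulation (cond r₁ r₂) (then′ eq t) =
    let _ , u , s = ⟶-simulation r₁ t in _ , then′ eq u , s
  ⟶-simulation (cond r₁ r₂) (else′ eq t) =
    let _ , u , s = ⟶-simulation r₂ t in _ , else′ eq u , s
  ⟶-simulation (plus r₁ r₂) (sumˡ t) =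
    let _ , u , s = ⟶-simulation r₁ t in _ , sumˡ u , s
  ⟶-simulation (plus r₁ r₂) (sumʳ t) =
    let _ , u , s = ⟶-simulation r₂ t in _ , sumʳ u , s
  ⟶-simulation (par r₁ r₂) (comˡ t₁ t₂) =
    let _ , u₁ , s₁ = offer-simulation r₁ t₁
        _ , u₂ , s₂ = offer-simulation r₂ t₂
    in _ , comˡ u₁ u₂ , Entrywise-point (refl , par s₁ s₂)
  ⟶-simulation (par r₁ r₂) (comʳ t₁ t₂) =
    let _ , u₁ , s₁ = offer-simulation r₁ t₁
        _ , u₂ , s₂ = offer-simulation r₂ t₂
    in _ , comʳ u₁ u₂ , Entrywise-point (refl , par s₁ s₂)
  ⟶-simulation (par r₁ r₂) (parˡ t) =
    let _ , u , s = ⟶-simulation r₁ t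
    in _ , parˡ u , Entrywise-context (λ s → par s r₂) s
  ⟶-simulation (par r₁ r₂) (parʳ t) =
    let _ , u , s = ⟶-simulation r₂ t in _ , parʳ u , Entrywise-context (par r₁) s
  ⟶-simulation (res ref) (res t) =
    let _ , u , s = ⟶-simulation ref t in _ , res u , Entrywise-context res s
  ⟶-simulation (left ref) t =
    let _ , u , s = ⟶-simulation ref t in _ , sumˡ u , s
  ⟶-simulation (right ref) t =
    let _ , u , s = ⟶-simulation ref t in _ , sumʳ u , s
  ⟶-simulation (split r₁ r₂) (then′ _ t) =
    let _ , u , s = ⟶-simulation r₁ t in _ , sumˡ u , s
  ⟶-simulation (split r₁ r₂) (else′ _ t) =
    let _ , u , s = ⟶-simulation r₂ t in _ , sumʳ u , s

  mapObs-⪯ᶜ : ∀ f {C′ C} → C′ ⪯ᶜ C → mapObs f C′ ⪯ᶜ mapObs f C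
  mapObs-⪯ᶜ f (process ref) = process ref
  mapObs-⪯ᶜ f deadlock      = deadlock

  -- The observer is common to both sides, so the same rule applies again and yields the same index;
  -- only reductions of the process and its offers to the observer call on the earlier simulations.
  ⇝-simulation : ∀ {ρ P′ P R π Θ′} → P′ ⪯ P → ⟪ ρ , P′ , R ⟫ ⇝[ π ] Θ′ →
                 ∃ λ Θ → ⟪ ρ , P , R ⟫ ⇝[ π ] Θ × Entrywise _⪯ᶜ_ Θ′ Θ
  ⇝-simulation ref (proc t) =
    let _ , u , s = ⟶-simulation ref t
    in _ , proc u , Entrywise-mapD (λ { (refl , ref) → process ref }) s
  ⇝-simulation ref (op a) = _ , op a , Entrywise-point (process ref)
  ⇝-simulation ref (meas m) =
    _ , meas m ,
    Entrywise-mapD (λ { refl → process ref }) (Entrywise-refl {R = _≡_} refl)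
  ⇝-simulation ref (recv t) =
    let _ , u , s = offer-simulation ref t in _ , recv u , Entrywise-point (process s)
  ⇝-simulation ref (send t) =
    let _ , u , s = offer-simulation ref t in _ , send u , Entrywise-point (process s)
  ⇝-simulation ref (then′ eq t) =
    let _ , u , s = ⇝-simulation ref t in _ , then′ eq u , s
  ⇝-simulation ref (else′ eq t) =
    let _ , u , s = ⇝-simulation ref t in _ , else′ eq u , s
  ⇝-simulation ref (parˡ t) =
    let _ , u , s = ⇝-simulation ref t
    in _ , parˡ u , Entrywise-mapD (mapObs-⪯ᶜ _) s
  ⇝-simulation ref (parʳ t) =
    let _ , u , s = ⇝-simulation ref t
    in _ , parʳ u , Entrywise-mapD (mapObs-⪯ᶜ _) s

  ⇝⊥-total : ∀ C π → ∃ (C ⇝⊥[ π ]_)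
  ⇝⊥-total C π with em {∃ (C ⇝[ π ]_)}
  ... | yes (Θ , t) = Θ , move t
  ... | no none     = point ⊥ , stuck (λ Θ t → none (Θ , t))

  ⇝⊥-simulation : ∀ {C′ C π Θ′} → C′ ⪯ᶜ C → C′ ⇝⊥[ π ] Θ′ →
                  ∃ λ Θ → C ⇝⊥[ π ] Θ × Θ′ ⪯ᴰ Θ
  ⇝⊥-simulation (process ref) (move t) =
    let Θ , u , s = ⇝-simulation ref t in Θ , move u , Entrywise⇒Lift s
  -- This also covers `⊥`, from which no rule starts. `C` may still move where its refinement
  -- cannot, so its step, real or to `point ⊥`, is supplied by excluded middle.
  ⇝⊥-simulation {C = C} {π} _ (stuck _) =
    let Θ , t = ⇝⊥-total C π in Θ , t , Lift-point (λ _ → deadlock) Θ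

theorem4p12 : (em : ExcludedMiddle 0ℓ) (ℝ : Reals) (N : ℕ) →
    let open LqCCS em ℝ N in
    (π : Index) (Δ′ Δ Θ′ : Dist ExtConf) →
    Δ′ ⪯ᴰ Δ → Δ′ ⇝⟨ π ⟩ Θ′ →
    ∃ λ Θ → Δ ⇝⟨ π ⟩ Θ × Θ′ ⪯ᴰ Θ
theorem4p12 em ℝ N π Δ′ Δ Θ′ =
  Expectation.LiftD-simulation em ℝ (Refinement.⇝⊥-simulation em ℝ N) Δ′ Δ Θ′
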